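{- Let $r\ge 1$ be an integer. In every spanning partition of a finite biclique into $r$ bi-equivalence graphs $G_1,\dots,G_r$, each $G_i$ has width at most $2^{r-1}$. This is best possible: for every $r\ge 1$ there is a spanning partition of some biclique into $r$ bi-equivalence graphs in which some $G_i$ has width exactly $2^{r-1}$.
   Context: A biclique $[X,Y]$ is a complete bipartite graph with nonempty vertex classes $X$ and $Y$. A bi-equivalence graph is a graph each of whose connected components is a biclique. A partition of a biclique $G$ into bi-equivalence graphs $G_1,\dots,G_r$ means that every edge of $G$ belongs to exactly one $G_i$, each $G_i$ being a bi-equivalence graph. The partition is spanning if every vertex of $G$ is incident with at least one edge of each $G_i$. The width of $G_i$ is the number of its connected components. -}

module Defs where

open import Data.Fin.Base using (Fin)
open import Data.Fin.Permutation using (↔⇒≡)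
open import Data.List.Base using (List)
open import Data.List.Membership.Propositional using (_∈_)
open import Data.Nat.Base using (ℕ)
open import Data.Product using (Σ; ∃; ∃!; _×_; _,_; proj₁)
open import Data.Sum.Base using (_⊎_)
open import Function.Base using (_on_)
open import Function.Bundles using (_⇔_; Inverse)
open import Function.Construct.Composition using (inverse)
open import Function.Construct.Symmetry using () renaming (inverse to inverse-sym)
open import Level using (0ℓ; suc)
open import Relation.Binary.Bundles using (Setoid)
open import Relation.Binary.Core using (Rel)
open import Relation.Binary.Construct.Closure.ReflexiveTransitive
  using (Star; ε; _◅◅_; reverse)
open import Relation.Binary.PropositionalEquality using (_≡_; setoid)
open import Relation.Nullary.Negation using (¬_)
open import Relation.Unary using (Pred; Satisfiable; _⊆_; _≐_; _∪_; _⊥_)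

-- Simple graphs whose vertices are the elements of A satisfying Vertex, so that
-- subgraphs of a graph are again graphs over the same A.
record Graph (A : Set) : Set (suc 0ℓ) where
  field
    Vertex   : Pred A 0ℓ
    Adj      : Rel A 0ℓ
    adj-sym  : ∀ {u v} → Adj u v → Adj v u
    adj-irr  : ∀ {v} → ¬ Adj v v
    endpoint : ∀ {u v} → Adj u v → Vertex u

open Graph public

Finite : {A : Set} → Graph A → Set
Finite {A} G = ∃ λ (vs : List A) → ∀ v → Vertex G v ⇔ v ∈ vs

record Subgraph {A : Set} (H G : Graph A) : Set where
  field
    vertices : Vertex H ⊆ Vertex G
    edges    : ∀ {u v} → Adj H u v → Adj G u v

induced : {A : Set} → Graph A → Pred A 0ℓ → Graph A
induced G C = record
  { Vertex   = λ v → Vertex G v × C v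
  ; Adj      = λ u v → Adj G u v × C u × C v
  ; adj-sym  = λ (e , cu , cv) → adj-sym G e , cv , cu
  ; adj-irr  = λ (e , _) → adj-irr G e
  ; endpoint = λ (e , cu , _) → endpoint G e , cu
  }

record IsBiclique {A : Set} (G : Graph A) : Set (suc 0ℓ) where
  field
    X Y        : Pred A 0ℓ
    X-nonempty : Satisfiable X
    Y-nonempty : Satisfiable Y
    disjoint   : X ⊥ Y
    vertices   : Vertex G ≐ X ∪ Y
    edges      : ∀ u v → Adj G u v ⇔ ((X u × Y v) ⊎ (Y u × X v))

Connected : {A : Set} → Graph A → Rel A 0ℓ
Connected G = Star (Adj G)

component : {A : Set} → Graph A → A → Graph A
component G v = induced G (Connected G v)

IsBiEquivalence : {A : Set} → Graph A → Set (suc 0ℓ)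
IsBiEquivalence G = ∀ v → Vertex G v → IsBiclique (component G v)

-- The set of connected components, as the vertices modulo connectedness.
Components : {A : Set} → Graph A → Setoid 0ℓ 0ℓ
Components {A} G = record
  { Carrier       = Σ A (Vertex G)
  ; _≈_           = Connected G on proj₁
  ; isEquivalence = record
    { refl  = ε
    ; sym   = reverse (adj-sym G)
    ; trans = _◅◅_
    }
  }

HasWidth : {A : Set} → Graph A → ℕ → Set
HasWidth G k = Inverse (Components G) (setoid (Fin k))

hasWidth-unique : ∀ {A : Set} (G : Graph A) {k l} → HasWidth G k → HasWidth G l → k ≡ l
hasWidth-unique G p q = ↔⇒≡ (inverse (inverse-sym p) q)

record IsPartition {A : Set} (G : Graph A) {r : ℕ} (H : Fin r → Graph A) : Set (suc 0ℓ) where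
  field
    biEquivalence : ∀ i → IsBiEquivalence (H i)
    subgraph      : ∀ i → Subgraph (H i) G
    exactlyOne    : ∀ {u v} → Adj G u v → ∃! _≡_ λ i → Adj (H i) u v

IsSpanning : {A : Set} → Graph A → {r : ℕ} → (Fin r → Graph A) → Set
IsSpanning G H = ∀ i v → Vertex G v → ∃ λ u → Adj (H i) v u

{-# OPTIONS --safe #-}
module Submission where

-- Upper bound: pick an edge x_c y_c in each component c of H_i, and record for
-- every other colour j the components of H_j containing x_c and y_c as integers
-- α_c(j) and β_c(j).  Since every edge has exactly one colour, the product over j
-- of β_d(j) − α_c(j) vanishes iff c ≠ d.  These products form an invertible
-- diagonal matrix, yet expanding them shows that its rank is at most 2^(r−1).
--
-- Sharpness: both vertex classes are the binary words of length r−1, and the edge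
-- between c and d is coloured by the first position where c and d differ, with one
-- more colour for c = d.  The graph of that last colour is a perfect matching.
open import Defs
open import Data.Bool.Base using (Bool; true; false; not; _xor_)
import Data.Bool.Properties as Bool
open import Data.Fin.Base
  using (Fin; zero; suc; toℕ; fromℕ; punchIn; punchOut; splitAt; combine; remQuot)
import Data.Fin.Properties as Fin
open import Data.Integer.Base using (ℤ; 0ℤ; 1ℤ; _+_; _*_; -_; _-_) renaming (+_ to pos)
import Data.Integer.Properties as ℤ
open import Data.Integer.Tactic.RingSolver using (solve-∀)
open import Data.List.Base using (List; []; _∷_; map; length; lookup; deduplicate; allFin)
open import Data.List.Membership.Propositional using (_∈_; mapWith∈)
open import Data.List.Membership.Propositional.Properties using (∈-lookup; ∈-map⁺; ∈-allFin)
import Data.List.Properties as List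
import Data.List.Relation.Unary.All as All
open import Data.List.Relation.Unary.AllPairs using (_∷_)
import Data.List.Relation.Unary.Any as Any
open import Data.List.Relation.Unary.Any.Properties using (lookup-index; mapWith∈⁺)
open import Data.List.Relation.Unary.Enumerates.Setoid using (IsEnumeration)
open import Data.List.Relation.Unary.Enumerates.Setoid.Properties using (deduplicate⁺)
open import Data.List.Relation.Unary.Unique.DecSetoid.Properties using (deduplicate-!)
open import Data.List.Relation.Unary.Unique.Setoid using (Unique)
open import Data.Nat.Base as ℕ using (ℕ; zero; suc; _≤_; _<_; s≤s; _∸_; _^_)
import Data.Nat.Properties as ℕ
open import Data.Product using (Σ; ∃; ∃₂; ∃!; _×_; _,_; proj₁; proj₂)
open import Data.Sum.Base using (_⊎_; inj₁; inj₂; [_,_]′)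
open import Data.Unit.Base using (⊤; tt)
open import Data.Vec.Base using (Vec; []; _∷_; head; tail; toList; replicate)
open import Data.Vec.Functional using (Vector; insertAt; _++_)
open import Data.Vec.Functional.Properties using (insertAt-lookup; insertAt-punchIn)
import Data.Vec.Properties as Vec
open import Function.Base using (_∘_; const)
open import Function.Bundles using (Inverse; Equivalence; _⇔_; mk⇔; _↔_; mk↔ₛ′)
open import Relation.Binary.Bundles using (Setoid; DecSetoid)
open import Relation.Binary.Construct.Closure.ReflexiveTransitive
  using (ε; _◅_; _◅◅_; reverse)
open import Relation.Binary.PropositionalEquality
  using (_≡_; _≢_; refl; sym; trans; cong; cong₂; subst; setoid; module ≡-Reasoning)
open import Relation.Nullary
  using (¬_; Dec; yes; no; ¬?; map′; _×-dec_; _⊎-dec_; decidable-stable)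
open import Relation.Nullary.Negation using (contradiction)

open import Algebra.Properties.Semiring.Sum ℤ.+-*-semiring
open Equivalence using (to; from)

-- Finite sums, linear dependence and rank over the integers.

sum-zero : ∀ {n} {t : Vector ℤ n} → (∀ i → t i ≡ 0ℤ) → sum t ≡ 0ℤ
sum-zero {n} eq = trans (sum-cong-≗ eq) (sum-replicate-zero n)

sum-only : ∀ {n} {t : Vector ℤ n} i → (∀ j → j ≢ i → t j ≡ 0ℤ) → sum t ≡ t i
sum-only {suc n} {t} i eq = begin
  sum t                             ≡⟨ sum-remove {i = i} t ⟩
  t i + sum (t ∘ punchIn i)         ≡⟨ cong (t i +_) (sum-zero λ j → eq _ (Fin.punchInᵢ≢i i j)) ⟩
  t i + 0ℤ                          ≡⟨ ℤ.+-identityʳ _ ⟩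
  t i                               ∎
  where open ≡-Reasoning

sum-++ : ∀ {m n} (s : Vector ℤ m) (t : Vector ℤ n) → sum (s ++ t) ≡ sum s + sum t
sum-++ {zero}  s t = sym (ℤ.+-identityˡ _)
sum-++ {suc m} s t = begin
  s zero + sum (λ i → (s ++ t) (suc i))  ≡⟨ cong (s zero +_) (sum-cong-≗ shift) ⟩
  s zero + sum ((s ∘ suc) ++ t)          ≡⟨ cong (s zero +_) (sum-++ (s ∘ suc) t) ⟩
  s zero + (sum (s ∘ suc) + sum t)       ≡⟨ ℤ.+-assoc (s zero) _ _ ⟨
  s zero + sum (s ∘ suc) + sum t         ∎
  where
  open ≡-Reasoning
  shift : ∀ i → (s ++ t) (suc i) ≡ ((s ∘ suc) ++ t) i
  shift i with splitAt m i
  ... | inj₁ _ = refl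
  ... | inj₂ _ = refl

-- Fraction-free Gaussian elimination: the vectors other than the pivot are
-- cross-multiplied with it to cancel their first coordinate.
dependent : ∀ {n k} → n < k → (u : Fin k → Vector ℤ n) →
  ∃ λ (w : Vector ℤ k) → (∃ λ c → w c ≢ 0ℤ) × (∀ s → ∑[ c < k ] (w c * u c s) ≡ 0ℤ)
dependent {zero}  {suc k} _ u = (λ _ → 1ℤ) , (zero , λ ()) , λ ()
dependent {suc n} {suc k} (s≤s n<k) u with Fin.any? (λ c → ¬? (u c zero ℤ.≟ 0ℤ))
... | no first≡0 =
  let w , w≢0 , rel = dependent (ℕ.m<n⇒m<1+n n<k) (λ c s → u c (suc s))
  in w , w≢0 , λ where
    zero    → sum-zero λ c → trans
      (cong (w c *_) (decidable-stable (u c zero ℤ.≟ 0ℤ) λ u≢0 → first≡0 (c , u≢0)))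
      (ℤ.*-zeroʳ (w c))
    (suc s) → rel s
... | yes (p , q≢0) = eliminate (dependent n<k (λ c s → reduced c (suc s)))
  where
  q = u p zero
  v = u ∘ punchIn p
  reduced : Fin k → Vector ℤ (suc n)
  reduced c s = q * v c s - v c zero * u p s

  eliminate : (∃ λ (w : Vector ℤ k) → (∃ λ c → w c ≢ 0ℤ) ×
                 (∀ s → ∑[ c < k ] (w c * reduced c (suc s)) ≡ 0ℤ)) →
              ∃ λ (w : Vector ℤ (suc k)) → (∃ λ c → w c ≢ 0ℤ) ×
                 (∀ s → ∑[ c < suc k ] (w c * u c s) ≡ 0ℤ)
  eliminate (w , (c , wc≢0) , rel) = w⁺ , (punchIn p c , w⁺c≢0) , λ s → trans (w⁺-sum s) (reduced-sum s)
    where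
    open ≡-Reasoning
    -- The coefficient of `u p` in the combination of the `reduced c`; each `v c` gets the
    -- coefficient `q * w c`.
    wₚ = ∑[ c < k ] (w c * - v c zero)
    w⁺ = insertAt (λ c → q * w c) p wₚ

    w⁺c≢0 : w⁺ (punchIn p c) ≢ 0ℤ
    w⁺c≢0 eq = [ q≢0 , wc≢0 ]′
      (ℤ.i*j≡0⇒i≡0∨j≡0 q (trans (sym (insertAt-punchIn _ p wₚ c)) eq))

    collect : ∀ a b q x y → a * - b * x + q * a * y ≡ a * (q * y - b * x)
    collect = solve-∀

    w⁺-sum : ∀ s → ∑[ c < suc k ] (w⁺ c * u c s) ≡ ∑[ c < k ] (w c * reduced c s)
    w⁺-sum s = begin
      ∑[ c < suc k ] (w⁺ c * u c s)
        ≡⟨ sum-remove {i = p} (λ c → w⁺ c * u c s) ⟩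
      w⁺ p * u p s + ∑[ c < k ] (w⁺ (punchIn p c) * v c s)
        ≡⟨ cong₂ _+_ (cong (_* u p s) (insertAt-lookup _ p wₚ))
             (sum-cong-≗ λ c → cong (_* v c s) (insertAt-punchIn _ p wₚ c)) ⟩
      wₚ * u p s + ∑[ c < k ] (q * w c * v c s)
        ≡⟨ cong (_+ ∑[ c < k ] (q * w c * v c s)) (*-distribʳ-sum (u p s) (λ c → w c * - v c zero)) ⟩
      ∑[ c < k ] (w c * - v c zero * u p s) + ∑[ c < k ] (q * w c * v c s)
        ≡⟨ ∑-distrib-+ (λ c → w c * - v c zero * u p s) _ ⟨
      ∑[ c < k ] (w c * - v c zero * u p s + q * w c * v c s)
        ≡⟨ sum-cong-≗ (λ c → collect (w c) (v c zero) q (u p s) (v c s)) ⟩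
      ∑[ c < k ] (w c * reduced c s) ∎

    cancel : ∀ a q b → a * (q * b - b * q) ≡ 0ℤ
    cancel = solve-∀

    reduced-sum : ∀ s → ∑[ c < k ] (w c * reduced c s) ≡ 0ℤ
    reduced-sum zero    = sum-zero λ c → cancel (w c) q (v c zero)
    reduced-sum (suc s) = rel s

-- Rank is encoded as a factorisation through `Vector ℤ n`, which makes sense over infinite index
-- types such as `Vector ℤ m`.
HasRank≤ : {A B : Set} → ℕ → (A → B → ℤ) → Set
HasRank≤ {A} {B} n M = ∃₂ λ (u : A → Vector ℤ n) (v : B → Vector ℤ n) →
  ∀ a b → M a b ≡ ∑[ s < n ] (u a s * v b s)

-- If `n < k`, a relation among the rows of the left factor is also one among the rows of `M`. In
-- column `c` it reduces to `w c * M c c ≡ 0ℤ`, although neither factor is zero.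
diagonal-rank : ∀ {n k} (M : Fin k → Fin k → ℤ) → HasRank≤ n M →
  (∀ c → M c c ≢ 0ℤ) → (∀ c d → c ≢ d → M c d ≡ 0ℤ) → k ≤ n
diagonal-rank {n} {k} M (u , v , M≡uv) diag off = ℕ.≮⇒≥ λ n<k →
  let w , (c , wc≢0) , rel = dependent n<k u
  in [ wc≢0 , diag c ]′ (ℤ.i*j≡0⇒i≡0∨j≡0 (w c) (begin
    w c * M c c
      ≡⟨ sum-only c (λ d d≢c → trans (cong (w d *_) (off d c d≢c)) (ℤ.*-zeroʳ (w d))) ⟨
    ∑[ d < k ] (w d * M d c)
      ≡⟨ sum-cong-≗ (λ d → trans (cong (w d *_) (M≡uv d c)) (*-distribˡ-sum (w d) λ s → u d s * v c s)) ⟩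
    ∑[ d < k ] ∑[ s < n ] (w d * (u d s * v c s))
      ≡⟨ ∑-comm (λ d s → w d * (u d s * v c s)) ⟩
    ∑[ s < n ] ∑[ d < k ] (w d * (u d s * v c s))
      ≡⟨ sum-cong-≗ (λ s → trans
           (sum-cong-≗ λ d → sym (ℤ.*-assoc (w d) (u d s) (v c s)))
           (sym (*-distribʳ-sum (v c s) (λ d → w d * u d s)))) ⟩
    ∑[ s < n ] ((∑[ d < k ] (w d * u d s)) * v c s)
      ≡⟨ sum-zero (λ s → cong (_* v c s) (rel s)) ⟩
    0ℤ ∎))
  where open ≡-Reasoning

-- Products of differences and the set-pair inequality.

∏-diff : ∀ {m} → Vector ℤ m → Vector ℤ m → ℤ
∏-diff {zero}  a z = 1ℤ
∏-diff {suc m} a z = (z zero - a zero) * ∏-diff (a ∘ suc) (z ∘ suc)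

-- Holds because ℤ has no zero divisors. Together with `∏-diff≡0`, it makes the vanishing of one
-- integer the test for agreement in some coordinate.
∏-diff≢0 : ∀ {m} (a z : Vector ℤ m) → (∀ j → a j ≢ z j) → ∏-diff a z ≢ 0ℤ
∏-diff≢0 {zero}  a z _   ()
∏-diff≢0 {suc m} a z a≢z eq with ℤ.i*j≡0⇒i≡0∨j≡0 (z zero - a zero) eq
... | inj₁ z-a≡0  = a≢z zero (sym (ℤ.i-j≡0⇒i≡j (z zero) (a zero) z-a≡0))
... | inj₂ rest≡0 = ∏-diff≢0 (a ∘ suc) (z ∘ suc) (a≢z ∘ suc) rest≡0

∏-diff≡0 : ∀ {m} (a z : Vector ℤ m) j → a j ≡ z j → ∏-diff a z ≡ 0ℤ
∏-diff≡0 a z zero    a≡z = cong (_* ∏-diff (a ∘ suc) (z ∘ suc)) (ℤ.i≡j⇒i-j≡0 (sym a≡z))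
∏-diff≡0 a z (suc j) a≡z = trans
  (cong ((z zero - a zero) *_) (∏-diff≡0 (a ∘ suc) (z ∘ suc) j a≡z))
  (ℤ.*-zeroʳ (z zero - a zero))

-- Expanding the product gives one term per set of coordinates.
∏-diff-rank : ∀ m → HasRank≤ (2 ^ m) (∏-diff {m})
∏-diff-rank zero    = (λ _ _ → 1ℤ) , (λ _ _ → 1ℤ) , λ _ _ → refl
∏-diff-rank (suc m) with ∏-diff-rank m
... | u , v , ∏≡uv = subst (λ n → HasRank≤ n (∏-diff {suc m}))
  -- `2 ^ suc m` computes to `N + (N + 0)`, but the factors are built with length `N + N`.
  (cong (2 ^ m ℕ.+_) (sym (ℕ.+-identityʳ (2 ^ m))))
  (u⁺ , v⁺ , expand)
  where
  open ≡-Reasoning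
  N = 2 ^ m

  -- The first block takes `z zero` from the leading factor, the second `- a zero`; each scalar is
  -- stored on the side that it depends on.
  u⁺ v⁺ : Vector ℤ (suc m) → Vector ℤ (N ℕ.+ N)
  u⁺ a = u (a ∘ suc) ++ (λ s → - a zero * u (a ∘ suc) s)
  v⁺ z = (λ s → z zero * v (z ∘ suc) s) ++ v (z ∘ suc)

  product-++ : ∀ (s s′ t t′ : Vector ℤ N) i →
    (s ++ t) i * (s′ ++ t′) i ≡ ((λ j → s j * s′ j) ++ (λ j → t j * t′ j)) i
  product-++ s s′ t t′ i with splitAt N i
  ... | inj₁ _ = refl
  ... | inj₂ _ = refl

  distribute : ∀ z a x → (z - a) * x ≡ z * x + - a * x
  distribute = solve-∀

  swap : ∀ z x y → z * (x * y) ≡ x * (z * y)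
  swap = solve-∀

  expand : ∀ a z → ∏-diff a z ≡ ∑[ s < N ℕ.+ N ] (u⁺ a s * v⁺ z s)
  expand a z = begin
    (z₀ - a₀) * ∏-diff (a ∘ suc) (z ∘ suc)
      ≡⟨ cong ((z₀ - a₀) *_) (∏≡uv (a ∘ suc) (z ∘ suc)) ⟩
    (z₀ - a₀) * sum uv
      ≡⟨ distribute z₀ a₀ (sum uv) ⟩
    z₀ * sum uv + - a₀ * sum uv
      ≡⟨ cong₂ _+_
           (trans (*-distribˡ-sum z₀ uv) (sum-cong-≗ λ s → swap z₀ (u′ s) (v′ s)))
           (trans (*-distribˡ-sum (- a₀) uv) (sum-cong-≗ λ s → sym (ℤ.*-assoc (- a₀) (u′ s) (v′ s)))) ⟩
    ∑[ s < N ] (u′ s * (z₀ * v′ s)) + ∑[ s < N ] (- a₀ * u′ s * v′ s)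
      ≡⟨ sum-++ (λ s → u′ s * (z₀ * v′ s)) _ ⟨
    sum ((λ s → u′ s * (z₀ * v′ s)) ++ (λ s → - a₀ * u′ s * v′ s))
      ≡⟨ sum-cong-≗ (product-++ u′ (λ s → z₀ * v′ s) (λ s → - a₀ * u′ s) v′) ⟨
    ∑[ s < N ℕ.+ N ] (u⁺ a s * v⁺ z s) ∎
    where
    a₀ = a zero
    z₀ = z zero
    u′ = u (a ∘ suc)
    v′ = v (z ∘ suc)
    uv = λ s → u′ s * v′ s

-- Alon's multipartite form of Bollobás's set-pair inequality, for one point
-- from each part on either side.
set-pairs : ∀ {m k} (α β : Fin k → Vector ℤ m) →
  (∀ c j → α c j ≢ β c j) →
  (∀ c d → c ≢ d → ∃ λ j → α c j ≡ β d j) →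
  k ≤ 2 ^ m
set-pairs {m} α β disjoint meet =
  let u , v , ∏≡uv = ∏-diff-rank m
  in diagonal-rank (λ c d → ∏-diff (α c) (β d))
       (u ∘ α , v ∘ β , λ c d → ∏≡uv (α c) (β d))
       (λ c → ∏-diff≢0 (α c) (β c) (disjoint c))
       (λ c d c≢d → let j , eq = meet c d c≢d in ∏-diff≡0 (α c) (β d) j eq)

-- Counting the classes of a finite decidable setoid.

module _ {c ℓ} (S : Setoid c ℓ) where
  private module S = Setoid S

  lookup-injective : ∀ {xs} → Unique S xs → ∀ i j → lookup xs i S.≈ lookup xs j → i ≡ j
  lookup-injective (x≉ ∷ u) zero    zero    eq = refl
  lookup-injective (x≉ ∷ u) zero    (suc j) eq = contradiction eq (All.lookup x≉ (∈-lookup j))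
  lookup-injective (x≉ ∷ u) (suc i) zero    eq = contradiction (S.sym eq) (All.lookup x≉ (∈-lookup i))
  lookup-injective (x≉ ∷ u) (suc i) (suc j) eq = cong suc (lookup-injective u i j eq)

-- After deduplication each class occurs exactly once in the list, so its position numbers it.
finite⇒Fin : ∀ {c ℓ} (S : DecSetoid c ℓ) {xs} → IsEnumeration (DecSetoid.setoid S) xs →
             ∃ λ k → Inverse (DecSetoid.setoid S) (setoid (Fin k))
finite⇒Fin S {xs} _∈xs = length ys , record
  { to        = index
  ; from      = lookup ys
  ; to-cong   = λ x≈y → unique _ _ (S.trans (S.sym (lookup≈ _)) (S.trans x≈y (lookup≈ _)))
  ; from-cong = λ i≡j → S.reflexive (cong (lookup ys) i≡j)
  ; inverse   = (λ x≈ → unique _ _ (S.trans (S.sym (lookup≈ _)) x≈))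
              , (λ i≡ → S.trans (S.reflexive (cong (lookup ys) i≡)) (S.sym (lookup≈ _)))
  }
  where
  module S = DecSetoid S
  ys      = deduplicate S._≟_ xs
  _∈ys    = deduplicate⁺ S _∈xs
  unique  = lookup-injective S.setoid (deduplicate-! S xs)
  index   = λ x → Any.index (x ∈ys)
  lookup≈ : ∀ x → x S.≈ lookup ys (index x)
  lookup≈ x = lookup-index (x ∈ys)

inverse-injective : ∀ {c ℓ d ℓ′} {S : Setoid c ℓ} {T : Setoid d ℓ′} (I : Inverse S T) →
  ∀ {x y} → Setoid._≈_ T (Inverse.to I x) (Inverse.to I y) → Setoid._≈_ S x y
inverse-injective {S = S} I eq = Setoid.trans S
  (Setoid.sym S (Inverse.strictlyInverseʳ I _)) (Inverse.inverseʳ I eq)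

-- Adjacency in bi-equivalence graphs and bicliques.

-- The ends of the edge lie in opposite classes of their component, so `v` is across from one of
-- them. This reduces connectedness to two adjacency tests.
connected⇒adj : ∀ {A} {K : Graph A} → IsBiEquivalence K → ∀ {u w v} →
  Adj K u w → Connected K u v → Adj K u v ⊎ Adj K w v
connected⇒adj {K = K} biEquivalence {u} {w} {v} u∼w u⇝v = conclude
  (to (edges u w) (u∼w , ε , u∼w ◅ ε))
  (proj₁ vertices (endpoint-of (reverse (adj-sym K) u⇝v) , u⇝v))
  where
  open IsBiclique (biEquivalence u (endpoint K u∼w))

  -- `Connected` is reflexive on all of `A`, so an empty path must borrow its vertex from `u∼w`.
  endpoint-of : ∀ {v} → Connected K v u → Vertex K v
  endpoint-of ε         = endpoint K u∼w
  endpoint-of (v∼ ◅ _) = endpoint K v∼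

  conclude : (X u × Y w) ⊎ (Y u × X w) → X v ⊎ Y v → Adj K u v ⊎ Adj K w v
  conclude (inj₁ (_  , Yw)) (inj₁ Xv) = inj₂ (proj₁ (from (edges w v) (inj₂ (Yw , Xv))))
  conclude (inj₁ (Xu , _))  (inj₂ Yv) = inj₁ (proj₁ (from (edges u v) (inj₁ (Xu , Yv))))
  conclude (inj₂ (Yu , _))  (inj₁ Xv) = inj₁ (proj₁ (from (edges u v) (inj₂ (Yu , Xv))))
  conclude (inj₂ (_  , Xw)) (inj₂ Yv) = inj₂ (proj₁ (from (edges w v) (inj₁ (Xw , Yv))))

module Biclique {A : Set} {G : Graph A} (biclique : IsBiclique G) where
  open IsBiclique biclique

  side : ∀ {v} → Vertex G v → X v ⊎ Y v
  side = proj₁ vertices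

  X? : ∀ {v} → Vertex G v → Dec (X v)
  X? Gv = [ yes , (λ Yv → no λ Xv → disjoint (Xv , Yv)) ]′ (side Gv)

  Y? : ∀ {v} → Vertex G v → Dec (Y v)
  Y? Gv = [ (λ Xv → no λ Yv → disjoint (Xv , Yv)) , yes ]′ (side Gv)

  adj? : ∀ {u v} → Vertex G u → Vertex G v → Dec (Adj G u v)
  adj? {u} {v} Gu Gv = map′ (from (edges u v)) (to (edges u v))
    ((X? Gu ×-dec Y? Gv) ⊎-dec (Y? Gu ×-dec X? Gv))

  opposite : ∀ {u v} → X u → Adj G u v → Y v
  opposite {u} {v} Xu u∼v with to (edges u v) u∼v
  ... | inj₁ (_ , Yv) = Yv
  ... | inj₂ (Yu , _) = contradiction (Xu , Yu) disjoint

  ¬adj-Y : ∀ {u v} → Y u → Y v → ¬ Adj G u v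
  ¬adj-Y {u} {v} Yu Yv u∼v with to (edges u v) u∼v
  ... | inj₁ (Xu , _) = disjoint (Xu , Yu)
  ... | inj₂ (_ , Xv) = disjoint (Xv , Yv)

-- The upper bound on the widths.

module SpanningPartition
  {A : Set} {G : Graph A} {m : ℕ} {H : Fin (suc m) → Graph A}
  (finite : Finite G) (biclique : IsBiclique G)
  (partition : IsPartition G H) (spanning : IsSpanning G H)
  where

  open IsPartition partition
  open IsBiclique biclique using (X; Y; edges) renaming (vertices to sides)
  open Biclique biclique

  H⊆G : ∀ i {v} → Vertex (H i) v → Vertex G v
  H⊆G i = Subgraph.vertices (subgraph i)

  G⊆H : ∀ i {v} → Vertex G v → Vertex (H i) v
  G⊆H i Gv = endpoint (H i) (proj₂ (spanning i _ Gv))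

  adj-H⊆G : ∀ i {u v} → Adj (H i) u v → Adj G u v
  adj-H⊆G i = Subgraph.edges (subgraph i)

  Xv⇒Gv : ∀ {v} → X v → Vertex G v
  Xv⇒Gv = proj₂ sides ∘ inj₁

  Yv⇒Gv : ∀ {v} → Y v → Vertex G v
  Yv⇒Gv = proj₂ sides ∘ inj₂

  edge-unique : ∀ {u v i j} → Adj (H i) u v → Adj (H j) u v → i ≡ j
  edge-unique {i = i} u∼v u∼′v =
    let _ , _ , unique = exactlyOne (adj-H⊆G i u∼v)
    in trans (sym (unique u∼v)) (unique u∼′v)

  -- An edge of `G` comes with its colour, which only has to be compared with `i`.
  adj-H? : ∀ i {u v} → Vertex G u → Vertex G v → Dec (Adj (H i) u v)
  adj-H? i Gu Gv with adj? Gu Gv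
  ... | no  u≁v = no (u≁v ∘ adj-H⊆G i)
  ... | yes u∼v =
    let j , u∼ⱼv , unique = exactlyOne u∼v
    in map′ (λ eq → subst (λ l → Adj (H l) _ _) eq u∼ⱼv) unique (j Fin.≟ i)

  connected? : ∀ i {u v} → Vertex G u → Vertex G v → Dec (Connected (H i) u v)
  connected? i Gu Gv =
    let w , u∼w = spanning i _ Gu
        Gw = H⊆G i (endpoint (H i) (adj-sym (H i) u∼w))
    in map′ [ _◅ ε , (λ w∼v → u∼w ◅ w∼v ◅ ε) ]′ (connected⇒adj (biEquivalence i) u∼w)
         (adj-H? i Gu Gv ⊎-dec adj-H? i Gw Gv)

  -- Otherwise `y` would be adjacent to a neighbour `w` of `x`, but `w` also lies in `Y`.
  connected-XY : ∀ i {x y} → X x → Y y → Connected (H i) x y → Adj (H i) x y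
  connected-XY i Xx Yy x⇝y with spanning i _ (Xv⇒Gv Xx)
  ... | w , x∼w with connected⇒adj (biEquivalence i) x∼w x⇝y
  ...   | inj₁ x∼y = x∼y
  ...   | inj₂ w∼y = contradiction (adj-H⊆G i w∼y) (¬adj-Y (opposite Xx (adj-H⊆G i x∼w)) Yy)

  components : Fin (suc m) → DecSetoid _ _
  components i = record
    { isDecEquivalence = record
      { isEquivalence = Setoid.isEquivalence (Components (H i))
      ; _≟_           = λ (_ , Hu) (_ , Hv) → connected? i (H⊆G i Hu) (H⊆G i Hv)
      }
    }

  width : ∀ i → ∃ (HasWidth (H i))
  width i = finite⇒Fin (components i) {vertices} λ (v , Hv) →
    -- The listed copy of `v` may carry another proof of being a vertex; `ε` suffices because
    -- components compare only the underlying points.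
    mapWith∈⁺ vertex (v , to (Gv⇔v∈vs v) (H⊆G i Hv) , ε)
    where
    vs      = proj₁ finite
    Gv⇔v∈vs = proj₂ finite
    vertex : ∀ {v} → v ∈ vs → Σ A (Vertex (H i))
    vertex v∈vs = _ , G⊆H i (from (Gv⇔v∈vs _) v∈vs)
    vertices = mapWith∈ vs vertex

  module _ {k : Fin (suc m) → ℕ} (widths : ∀ i → HasWidth (H i) (k i)) where

    label : Fin (suc m) → ∀ {v} → Vertex G v → ℤ
    label i Gv = pos (toℕ (Inverse.to (widths i) (_ , G⊆H i Gv)))

    label-cong : ∀ i {u v} (Gu : Vertex G u) (Gv : Vertex G v) →
      Connected (H i) u v → label i Gu ≡ label i Gv
    label-cong i Gu Gv u⇝v = cong (pos ∘ toℕ) (Inverse.to-cong (widths i) u⇝v)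

    label-injective : ∀ i {u v} (Gu : Vertex G u) (Gv : Vertex G v) →
      label i Gu ≡ label i Gv → Connected (H i) u v
    label-injective i Gu Gv eq =
      inverse-injective (widths i) (Fin.toℕ-injective (ℤ.+-injective eq))

    root : ∀ i → Fin (k i) → A
    root i c = proj₁ (Inverse.from (widths i) c)

    -- The edge is oriented from `X` to `Y`, so that the `x` of one component and the `y` of another
    -- are always adjacent in `G`.
    record EdgeInComponent i (c : Fin (k i)) : Set where
      field
        {x y}   : A
        Xx      : X x
        Yy      : Y y
        x∼y     : Adj (H i) x y
        root⇝x  : Connected (H i) (root i c) x

    edge-in-component : ∀ i c → EdgeInComponent i c
    edge-in-component i c with spanning i (root i c) Groot | side Groot
      where Groot = H⊆G i (proj₂ (Inverse.from (widths i) c))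
    ... | w , v∼w | inj₁ Xv = record
      { Xx = Xv ; Yy = opposite Xv (adj-H⊆G i v∼w) ; x∼y = v∼w ; root⇝x = ε }
    ... | w , v∼w | inj₂ Yv with side (H⊆G i (endpoint (H i) (adj-sym (H i) v∼w)))
    ...   | inj₁ Xw = record { Xx = Xw ; Yy = Yv ; x∼y = adj-sym (H i) v∼w ; root⇝x = v∼w ◅ ε }
    ...   | inj₂ Yw = contradiction (adj-H⊆G i v∼w) (¬adj-Y Yv Yw)

    width-bound : ∀ i → k i ≤ 2 ^ m
    width-bound i = set-pairs α β disjoint meet
      where
      module I = Inverse (widths i)
      open module E c = EdgeInComponent (edge-in-component i c)

      α β : Fin (k i) → Fin m → ℤ
      -- `punchIn i` skips colour `i`; the remaining `m` colours account for the exponent r - 1.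
      α c j = label (punchIn i j) (Xv⇒Gv (Xx c))
      β c j = label (punchIn i j) (Yv⇒Gv (Yy c))

      -- Equal labels would give the edge from `x c` to `y c`, already of colour `i`, a second
      -- colour.
      disjoint : ∀ c j → α c j ≢ β c j
      disjoint c j eq = Fin.punchInᵢ≢i i j (edge-unique
        (connected-XY _ (Xx c) (Yy c)
          (label-injective (punchIn i j) (Xv⇒Gv (Xx c)) (Yv⇒Gv (Yy c)) eq))
        (x∼y c))

      same-component : ∀ c d → Adj (H i) (x c) (y d) → c ≡ d
      same-component c d xc∼yd = trans (sym (I.strictlyInverseˡ c))
        (trans (I.to-cong (root⇝x c ◅◅ xc∼yd ◅ adj-sym (H i) (x∼y d) ◅
                           reverse (adj-sym (H i)) (root⇝x d)))
               (I.strictlyInverseˡ d))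

      -- The witness is the colour of the edge from `x c` to `y d`. It is not `i`, as that edge
      -- would join the components `c` and `d`.
      meet : ∀ c d → c ≢ d → ∃ λ j → α c j ≡ β d j
      meet c d c≢d with exactlyOne (from (edges (x c) (y d)) (inj₁ (Xx c , Yy d)))
      ... | j , x∼ⱼy , _ = punchOut i≢j , label-cong _ (Xv⇒Gv (Xx c)) (Yv⇒Gv (Yy d))
        (subst (λ l → Connected (H l) (x c) (y d)) (sym (Fin.punchIn-punchOut i≢j)) (x∼ⱼy ◅ ε))
        where
        i≢j : i ≢ j
        i≢j refl = c≢d (same-component c d x∼ⱼy)

-- Bipartite graphs defined by a side and a label.

module Labelled {A L : Set} (side : A → Bool) (label : A → L) where

  -- Both the biclique of the example and its colour classes have this form.
  graph : Graph A
  graph = record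
    { Vertex   = const ⊤
    ; Adj      = λ u v → side u ≡ not (side v) × label u ≡ label v
    ; adj-sym  = λ (s , l) → trans (sym (Bool.not-involutive _)) (cong not (sym s)) , sym l
    ; adj-irr  = λ (s , _) → Bool.not-¬ refl s
    ; endpoint = const tt
    }

  connected⇒label≡ : ∀ {u v} → Connected graph u v → label u ≡ label v
  connected⇒label≡ ε             = refl
  connected⇒label≡ ((_ , l) ◅ p) = trans l (connected⇒label≡ p)

  module _ (neighbour : ∀ v → ∃ (Adj graph v)) where

    -- Vertices on opposite sides are adjacent; on the same side, a neighbour of `u` links them in
    -- two steps.
    label≡⇒connected : ∀ {u v} → label u ≡ label v → Connected graph u v
    label≡⇒connected {u} {v} l with side u Bool.≟ not (side v) | neighbour u
    ... | yes s | _ = (s , l) ◅ ε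
    ... | no ¬s | w , u∼w@(s′ , l′) = u∼w ◅ (w∼v , trans (sym l′) l) ◅ ε
      where
      w∼v : side w ≡ not (side v)
      w∼v = Bool.not-injective (trans (sym s′) (Bool.¬-not ¬s))

    -- The component of `v` is its label class, split by side; `v` and its neighbour show that both
    -- halves are inhabited.
    biEquivalence : IsBiEquivalence graph
    biEquivalence v _ = record
      { X          = λ u → side u ≡ true  × label u ≡ label v
      ; Y          = λ u → side u ≡ false × label u ≡ label v
      ; X-nonempty = meets-side true
      ; Y-nonempty = meets-side false
      ; disjoint   = λ ((s , _) , (s′ , _)) → contradiction (trans (sym s) s′) λ ()
      ; vertices   = split , λ where
          (inj₁ (_ , l)) → tt , label≡⇒connected (sym l)
          (inj₂ (_ , l)) → tt , label≡⇒connected (sym l)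
      ; edges      = λ u w → mk⇔ (crossing u w) λ where
          (inj₁ (Xu , Yw)) → edge Xu Yw
          (inj₂ (Yu , Xw)) → edge Yu Xw
      }
      where
      meets-side : ∀ b → ∃ λ u → side u ≡ b × label u ≡ label v
      meets-side b with side v Bool.≟ b | neighbour v
      ... | yes s | _           = v , s , refl
      ... | no ¬s | w , s′ , l′ = w , Bool.not-injective (trans (sym s′) (Bool.¬-not ¬s)) , sym l′

      split : ∀ {u} → ⊤ × Connected graph v u →
        (side u ≡ true × label u ≡ label v) ⊎ (side u ≡ false × label u ≡ label v)
      split {u} (_ , v⇝u) with side u
      ... | true  = inj₁ (refl , sym (connected⇒label≡ v⇝u))
      ... | false = inj₂ (refl , sym (connected⇒label≡ v⇝u))

      -- Leaving `t` open serves both orientations of the edge.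
      edge : ∀ {t u w} → side u ≡ not t × label u ≡ label v →
             side w ≡ t × label w ≡ label v → Adj (component graph v) u w
      edge (s , l) (s′ , l′) =
        (trans s (cong not (sym s′)) , trans l (sym l′)) ,
        label≡⇒connected (sym l) , label≡⇒connected (sym l′)

      crossing : ∀ u w → Adj (component graph v) u w →
        ((side u ≡ true × label u ≡ label v) × (side w ≡ false × label w ≡ label v)) ⊎
        ((side u ≡ false × label u ≡ label v) × (side w ≡ true × label w ≡ label v))
      crossing u w ((s , _) , v⇝u , v⇝w)
        with side u | side w | sym (connected⇒label≡ v⇝u) | sym (connected⇒label≡ v⇝w)
      ... | true  | false | lu | lw = inj₁ ((refl , lu) , (refl , lw))
      ... | false | true  | lu | lw = inj₂ ((refl , lu) , (refl , lw))
      ... | true  | true  | _  | _  = contradiction s λ ()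
      ... | false | false | _  | _  = contradiction s λ ()

-- Binary words and their prefixes.

Vec-Bool↔Fin : ∀ n → Vec Bool n ↔ Fin (2 ^ n)
Vec-Bool↔Fin zero    = mk↔ₛ′ (const zero) (const []) (λ { zero → refl }) (λ { [] → refl })
Vec-Bool↔Fin (suc n) = mk↔ₛ′ encode decode encode-decode decode-encode
  where
  module I = Inverse (Vec-Bool↔Fin n)
  module B = Inverse Fin.2↔Bool

  encode : Vec Bool (suc n) → Fin (2 ^ suc n)
  encode (b ∷ c) = combine (B.from b) (I.to c)

  decode : Fin (2 ^ suc n) → Vec Bool (suc n)
  decode i = let q , s = remQuot {2} (2 ^ n) i in B.to q ∷ I.from s

  encode-decode : ∀ i → encode (decode i) ≡ i
  encode-decode i = let q , s = remQuot {2} (2 ^ n) i in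
    trans (cong₂ combine (B.strictlyInverseʳ q) (I.strictlyInverseˡ s))
          (Fin.combine-remQuot {2} (2 ^ n) i)

  decode-encode : ∀ v → decode (encode v) ≡ v
  decode-encode (b ∷ c) = trans
    (cong (λ (q , s) → B.to q ∷ I.from s) (Fin.remQuot-combine (B.from b) (I.to c)))
    (cong₂ _∷_ (B.strictlyInverseˡ b) (I.strictlyInverseʳ c))

-- The word c up to and including its j-th bit, that bit being flipped if s;
-- for the last j, which is past the end of c, the whole of c.
prefix : ∀ {m} → Bool → Fin (suc m) → Vec Bool m → List Bool
prefix s zero    []      = []
prefix s zero    (b ∷ _) = (s xor b) ∷ []
prefix s (suc j) (b ∷ c) = b ∷ prefix s j c

prefix-fromℕ : ∀ {m} s (c : Vec Bool m) → prefix s (fromℕ m) c ≡ toList c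
prefix-fromℕ s []      = refl
prefix-fromℕ s (b ∷ c) = cong (b ∷_) (prefix-fromℕ s c)

-- Flipping the `j`-th bit of the word compensates for the change of `s`; past the end `d` is `c`
-- itself. This supplies a neighbour in every colour.
prefix-not : ∀ {m} s j (c : Vec Bool m) → ∃ λ d → prefix s j c ≡ prefix (not s) j d
prefix-not s     zero    []      = [] , refl
prefix-not s     (suc j) (b ∷ c) = let d , eq = prefix-not s j c in b ∷ d , cong (b ∷_) eq
prefix-not true  zero    (b ∷ c) = not b ∷ c , refl
prefix-not false zero    (b ∷ c) = not b ∷ c , cong (_∷ []) (sym (Bool.not-involutive b))

xor-not : ∀ s b b′ → (s xor b ≡ not s xor b′) ⇔ (b ≢ b′)
xor-not true  b b′ = mk⇔ (λ eq b≡b′ → Bool.not-¬ (sym b≡b′) (sym eq)) λ b≢b′ → sym (Bool.¬-not (b≢b′ ∘ sym))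
xor-not false b b′ = mk⇔ (λ eq b≡b′ → Bool.not-¬ b≡b′ eq) Bool.¬-not

-- The unique j is the first position where c and d differ, or the last j if c = d.
first-difference : ∀ {m} s (c d : Vec Bool m) →
  ∃! _≡_ λ j → prefix s j c ≡ prefix (not s) j d
first-difference s []      []       = zero , refl , λ { {zero} _ → refl }
first-difference s (b ∷ c) (b′ ∷ d) with b Bool.≟ b′ | first-difference s c d
... | yes refl | j , eq , unique = suc j , cong (b ∷_) eq , λ
  { {zero}  eq′ → contradiction refl (to (xor-not s b b) (List.∷-injectiveˡ eq′))
  ; {suc _} eq′ → cong suc (unique (List.∷-injectiveʳ eq′))
  }
... | no b≢b′  | _ = zero , cong (_∷ []) (from (xor-not s b b′) b≢b′) , λ
  { {zero}  _   → refl
  ; {suc _} eq′ → contradiction (List.∷-injectiveˡ eq′) b≢b′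
  }

-- The extremal example.

module Cube (m : ℕ) where

  -- The first bit of a vertex is its side and also the flip of `prefix`. Across the two sides,
  -- equal labels at a position inside the words thus mean agreement before it and difference at it.
  label : Fin (suc m) → Vec Bool (suc m) → List Bool
  label i (s ∷ c) = prefix s i c

  -- A constant label makes the graph complete bipartite.
  module K = Labelled {Vec Bool (suc m)} head (const tt)
  module H (i : Fin (suc m)) = Labelled head (label i)

  finite : Finite K.graph
  finite = map I.from (allFin _) , λ v → mk⇔
    (λ _ → subst (_∈ _) (I.strictlyInverseʳ v) (∈-map⁺ I.from (∈-allFin (I.to v))))
    (const tt)
    where module I = Inverse (Vec-Bool↔Fin (suc m))

  biclique : IsBiclique K.graph
  biclique = record
    { X          = λ v → head v ≡ true
    ; Y          = λ v → head v ≡ false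
    ; X-nonempty = replicate _ true , refl
    ; Y-nonempty = replicate _ false , refl
    ; disjoint   = λ (s , s′) → contradiction (trans (sym s) s′) λ ()
    ; vertices   = (λ {v} _ → split v) , const tt
    ; edges      = λ u v → mk⇔ (λ (s , _) → crossing u v s) λ where
        (inj₁ (s , s′)) → trans s (cong not (sym s′)) , refl
        (inj₂ (s , s′)) → trans s (cong not (sym s′)) , refl
    }
    where
    split : ∀ v → head v ≡ true ⊎ head v ≡ false
    split (true  ∷ _) = inj₁ refl
    split (false ∷ _) = inj₂ refl

    crossing : ∀ (u v : Vec Bool (suc m)) → head u ≡ not (head v) →
      (head u ≡ true × head v ≡ false) ⊎ (head u ≡ false × head v ≡ true)
    crossing (true  ∷ _) (false ∷ _) _ = inj₁ (refl , refl)
    crossing (false ∷ _) (true  ∷ _) _ = inj₂ (refl , refl)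

  spanning : IsSpanning K.graph H.graph
  spanning i (s ∷ c) _ =
    let d , eq = prefix-not s i c in not s ∷ d , sym (Bool.not-involutive s) , eq

  neighbour : ∀ i v → ∃ (Adj (H.graph i) v)
  neighbour i v = spanning i v tt

  partition : IsPartition K.graph H.graph
  partition = record
    { biEquivalence = λ i → H.biEquivalence i (neighbour i)
    ; subgraph      = λ i → record { vertices = λ _ → tt ; edges = λ (s , _) → s , refl }
    ; exactlyOne    = λ {u} {v} (s , _) → exactlyOne u v s
    }
    where
    exactlyOne : ∀ u v → head u ≡ not (head v) → ∃! _≡_ λ i → Adj (H.graph i) u v
    exactlyOne (.(not s) ∷ c) (s ∷ d) refl with first-difference s d c
    -- The flip `s` belongs to the second vertex, so `d` came first in `first-difference` and the
    -- equations are reversed.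
    ... | j , eq , unique = j , (refl , sym eq) , λ (_ , eq′) → unique (sym eq′)

  -- In the last colour the label is the whole word, so each component is a single edge between the
  -- two copies of a word.
  matching-width : HasWidth (H.graph (fromℕ m)) (2 ^ m)
  matching-width = record
    { to        = λ (v , _) → I.to (tail v)
    -- Either endpoint of the matching edge could represent it; `false` is an arbitrary choice.
    ; from      = λ k → false ∷ I.from k , tt
    ; to-cong   = λ {x} {y} p → cong I.to (tail≡ (proj₁ x) (proj₁ y) p)
    ; from-cong = λ { refl → ε }
    ; inverse   = (λ {k} {x} p → trans (cong I.to (tail≡ (proj₁ x) (false ∷ I.from k) p))
                                       (I.strictlyInverseˡ k))
                , λ { {s ∷ c , _} refl → H.label≡⇒connected (fromℕ m) (neighbour (fromℕ m))
                        (trans (prefix-fromℕ false _)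
                          (trans (cong toList (I.strictlyInverseʳ c)) (sym (prefix-fromℕ s c)))) }
    }
    where
    module I = Inverse (Vec-Bool↔Fin m)

    tail≡ : ∀ u v → Connected (H.graph (fromℕ m)) u v → tail u ≡ tail v
    -- `Vec.toList-injective` yields an equality up to `cast`, which is the identity here.
    tail≡ (s ∷ c) (t ∷ d) p = trans (sym (Vec.cast-is-id refl c)) (Vec.toList-injective refl c d
      (trans (sym (prefix-fromℕ s c)) (trans (H.connected⇒label≡ (fromℕ m) p) (prefix-fromℕ t d))))

theorem3 : ∀ (r : ℕ) → 1 ≤ r →
    (∀ (A : Set) (G : Graph A) (H : Fin r → Graph A) →
    Finite G → IsBiclique G → IsPartition G H → IsSpanning G H →
    ∀ i → ∃ λ k → HasWidth (H i) k × k ≤ 2 ^ (r ∸ 1))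
    ×
    (Σ Set λ A → Σ (Graph A) λ G → Σ (Fin r → Graph A) λ H →
    Finite G × IsBiclique G × IsPartition G H × IsSpanning G H ×
    ∃ λ i → HasWidth (H i) (2 ^ (r ∸ 1)))
theorem3 (suc m) _ =
  (λ A G H finite biclique partition spanning i →
    let open SpanningPartition finite biclique partition spanning
    in proj₁ (width i) , proj₂ (width i) , width-bound (proj₂ ∘ width) i) ,
  (_ , _ , _ , finite , biclique , partition , spanning , fromℕ m , matching-width)
  where open Cube m
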